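{- For each integer $a\ge 0$, there exists an integer $t_1=t_1(a)$ such that for every integer $t\ge t_1$, there exists a $K_t$-minor-free graph that is not $\{1\star (t-2a-6),\,3a+6\}$-choosable.
   Context: All graphs are finite and simple. A graph is $K_t$-minor-free if $K_t$ cannot be obtained from a subgraph of it by contracting edges. A list assignment $L$ of a graph $G$ assigns to each vertex $v$ a set $L(v)$ of colours; an $L$-colouring is a proper colouring $f$ with $f(v)\in L(v)$ for all $v$. For a multiset $\lambda=\{k_1,\dots,k_q\}$ of positive integers, a $\lambda$-list assignment of $G$ is a list assignment $L$ such that the colour set $\bigcup_{v\in V(G)}L(v)$ can be partitioned into $q$ sets $C_1,\dots,C_q$ with $|L(v)\cap C_i|\ge k_i$ for every $i$ and every vertex $v$. $G$ is $\lambda$-choosable if $G$ is $L$-colourable for every $\lambda$-list assignment $L$. The notation $b\star m$ inside a multiset means $m$ copies of $b$; so $\{1\star(t-2a-6),3a+6\}$ consists of $t-2a-6$ ones and one copy of $3a+6$. -}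

module Defs where

open import Level using (0ℓ; suc)
open import Data.Nat.Base using (ℕ; _≤_)
open import Data.Fin.Base using (Fin)
open import Data.Fin.Properties using (_≟_)
open import Data.Fin.Subset using (Subset; _∈_; _∩_; ⋃; ∣_∣; Empty)
open import Data.List.Base using (List; length; lookup; replicate; tabulate)
open import Data.Product.Base using (Σ; ∃₂; _×_)
open import Data.Sum.Base using (_⊎_)
open import Function.Bundles using (_⇔_)
open import Function.Definitions using (Injective; StrictlySurjective)
open import Relation.Binary.Core using (Rel)
open import Relation.Binary.Definitions using (Decidable; Irreflexive; Symmetric)
open import Relation.Binary.Construct.Closure.ReflexiveTransitive using (Star)
open import Relation.Binary.PropositionalEquality.Core using (_≡_; _≢_; ≢-sym)
open import Relation.Nullary.Decidable.Core using (¬?)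
open import Relation.Nullary.Negation.Core using (¬_)

record Graph : Set (suc 0ℓ) where
  field
    order  : ℕ
    Adj    : Rel (Fin order) 0ℓ
    sym    : Symmetric Adj
    irrefl : Irreflexive _≡_ Adj
    adj?   : Decidable Adj

  Vertex : Set
  Vertex = Fin order

open Graph using (Vertex; Adj)

K : ℕ → Graph
K t = record
  { order  = t
  ; Adj    = _≢_
  ; sym    = ≢-sym
  ; irrefl = λ x≡y x≢y → x≢y x≡y
  ; adj?   = λ x y → ¬? (x ≟ y)
  }

-- H is, up to isomorphism, a (not necessarily induced) subgraph of G.
record _⊑_ (H G : Graph) : Set where
  field
    embed     : Vertex H → Vertex G
    injective : Injective _≡_ _≡_ embed
    preserves : ∀ {x y} → Adj H x y → Adj G (embed x) (embed y)

-- Contracts G H: H is, up to isomorphism, the simple graph obtained from G by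
-- contracting the single edge uv; quot is the quotient map on vertices, which
-- identifies u with v and nothing else.
record Contracts (G H : Graph) : Set where
  field
    u v        : Vertex G
    edge       : Adj G u v
    quot       : Vertex G → Vertex H
    surjective : StrictlySurjective _≡_ quot
    fibres     : ∀ x y → quot x ≡ quot y ⇔ (x ≡ y ⊎ (x ≡ u × y ≡ v) ⊎ (x ≡ v × y ≡ u))
    adjacent   : ∀ p q → Adj H p q ⇔
                   (p ≢ q × ∃₂ λ x y → quot x ≡ p × quot y ≡ q × Adj G x y)

-- Isomorphic copies need no separate treatment: _⊑_ is already up to
-- isomorphism, which covers the case of zero contractions.
_IsMinorOf_ : Graph → Graph → Set₁
H IsMinorOf G = Σ Graph λ S → S ⊑ G × Star Contracts S H

_-MinorFree_ : ℕ → Graph → Set₁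
t -MinorFree G = ¬ (K t IsMinorOf G)

-- Lists are finite sets of colours, drawn from a palette Fin m of any size m.
ListAssignment : Graph → ℕ → Set
ListAssignment G m = Vertex G → Subset m

record Colouring (G : Graph) {m : ℕ} (L : ListAssignment G m) : Set where
  field
    colour   : Vertex G → Fin m
    proper   : ∀ {x y} → Adj G x y → colour x ≢ colour y
    fromList : ∀ x → colour x ∈ L x

-- A multiset {k₁,…,k_q} is represented by a list enumerating it; the order of
-- the entries is immaterial below.
Multiset : Set
Multiset = List ℕ

infix 6 _⋆_
_⋆_ : ℕ → ℕ → Multiset
b ⋆ m = replicate m b

record IsListAssignmentOf (ks : Multiset) (G : Graph) {m : ℕ} (L : ListAssignment G m) : Set where
  field
    part     : Fin (length ks) → Subset m
    disjoint : ∀ {i j} → i ≢ j → Empty (part i ∩ part j)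
    covers   : ⋃ (tabulate part) ≡ ⋃ (tabulate L)
    large    : ∀ i x → lookup ks i ≤ ∣ L x ∩ part i ∣

_-Choosable_ : Multiset → Graph → Set
ks -Choosable G = ∀ {m} (L : ListAssignment G m) → IsListAssignmentOf ks G L → Colouring G L

{-# OPTIONS --safe #-}
module Submission where

-- Put s = t − 2a − 6 and z = 2a + 5.  Start from a clique on s + z = t − 1 vertices in which
-- each vertex has the s shared singleton colours and 3a + 6 private ones; in every colouring
-- at least z vertices use a private colour.  For each choice of z vertices and of a private
-- colour for each of them, add a gadget: a clique on t − 2 new vertices, each joined to at
-- least a + 3 of the z vertices, every such set of neighbours being used by at least z gadget
-- vertices.  The list of a gadget vertex consists of the shared colours, the chosen colours of
-- its neighbours and 2a + 3 further colours.  In the gadget matching a given colouring only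
-- s + (2a + 3) = t − 3 colours remain usable, too few for its t − 2 vertices.
--
-- Given a K_t model, some branch set misses the base clique and so lies in one gadget; hence
-- every branch set meets that gadget or its attachment set Z of size z.  At least two branch
-- sets miss the gadget, and as |Z| = 2a + 5 one of them leaves at least a + 3 vertices of Z
-- uncovered.  At least z gadget vertices are then not adjacent to it, so too few are left for
-- the branch sets that avoid Z.

open import Defs
open import Data.Empty using (⊥)
open import Data.Fin.Base using (Fin; zero; suc; splitAt; join; inject≤; combine; remQuot; finToFun; funToFin; punchIn; _↑ˡ_; _↑ʳ_)
open import Data.Fin.Properties using (_≟_; suc-injective; 0≢1+n; any?; all?; ¬∀⟶∃¬; injective⇒≤; <⇒notInjective; inject≤-injective; ↑ˡ-injective; ↑ʳ-injective; splitAt-↑ˡ; combine-injectiveʳ; remQuot-combine; finToFun-funToFin; punchIn-injective; punchInᵢ≢i; splitAt-↑ʳ; join-splitAt; +↔⊎; *↔×; 2↔Bool)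
open import Data.Fin.Subset using (Subset; inside; outside; _∈_; _∩_; _-_; ∁; ⋃; ∣_∣) renaming (⊤ to full)
open import Data.Fin.Subset.Properties using (_∈?_; ∣⊤∣≡n; p⊆q⇒∣p∣≤∣q∣; ⊆-antisym; ∣∁p∣≡n∸∣p∣; x∈p⇒x∉∁p; x∈∁p⇒x∉p; x∉p⇒x∈∁p; x∈p∩q⁺; x∈p∩q⁻; x∈p∪q⁺; x∈p∪q⁻; x∈p⇒∣p-x∣<∣p∣; x∈p∧x≢y⇒x∈p-y; ∉⊥)
open import Data.List.Base using (length; lookup; tabulate; _++_; [_])
open import Data.Maybe.Base using (Maybe; just; nothing)
import Data.Maybe.Base as Maybe
import Data.Maybe.Properties as Maybe
open import Data.Nat.Base using (ℕ; zero; suc; _+_; _*_; _∸_; _^_; _≤_; _<_; z≤n)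
open import Data.Nat.Properties using (≤-refl; ≤-trans; ≤-reflexive; ≤-<-trans; _≤?_; ≰⇒>; +-comm; +-monoʳ-≤; +-cancelˡ-≤; <-trans; ≤-pred; +-suc; m∸n+n≡m; m≤n+m∸n; m≤m+n; m≤n+m; m≤n⇒∃[o]m+o≡n; ∸-+-assoc; m+n≤o⇒m≤o∸n)
open import Data.Nat.Tactic.RingSolver using (solve-∀)
open import Data.Product.Base using (Σ; ∃; ∃₂; _×_; _,_; proj₁; proj₂)
import Data.Product.Properties as Product
open import Data.Sum.Base using (_⊎_; inj₁; inj₂; [_,_]′)
open import Data.Sum.Function.Propositional using (_⊎-↔_)
open import Data.Sum.Properties using (inj₁-injective; inj₂-injective)
import Data.Sum.Properties as Sum
open import Data.Unit.Base using (⊤; tt)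
open import Data.Vec.Base using (_∷_)
import Data.Vec.Base as Vec
open import Data.Vec.Properties using (lookup∘tabulate; tabulate∘lookup; tabulate-cong; []=⇒lookup; lookup⇒[]=)
open import Function.Base using (_∘_; id)
open import Function.Bundles using (_↔_; Inverse; module Equivalence)
open import Function.Construct.Composition using (_↔-∘_)
open import Function.Construct.Identity using (↔-id)
open import Function.Definitions using (Injective)
open import Level using (0ℓ)
open import Relation.Binary.Construct.Closure.ReflexiveTransitive using (Star; ε; _◅_)
open import Relation.Binary.Core using (Rel)
open import Relation.Binary.Definitions using (DecidableEquality)
open import Relation.Binary.PropositionalEquality using (_≡_; _≢_; _≗_; refl; sym; trans; cong; subst; subst₂)
open import Relation.Nullary using (Dec; yes; no; does; ¬_; contradiction)
open import Relation.Nullary.Decidable using (dec-true; _×-dec_; _→-dec_; ¬?)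
open import Relation.Unary using (Pred; Decidable)

private
  variable
    m n : ℕ

-- Finite sets

collect : {P : Pred (Fin n) 0ℓ} → Decidable P → Subset n
collect P? = Vec.tabulate (does ∘ P?)

∈-collect⁺ : {P : Pred (Fin n) 0ℓ} (P? : Decidable P) {x : Fin n} → P x → x ∈ collect P?
∈-collect⁺ P? {x} px = lookup⇒[]= x _ (trans (lookup∘tabulate (does ∘ P?) x) (dec-true (P? x) px))

∈-collect⁻ : {P : Pred (Fin n) 0ℓ} (P? : Decidable P) {x : Fin n} → x ∈ collect P? → P x
∈-collect⁻ P? {x} x∈ with P? x | trans (sym (lookup∘tabulate (does ∘ P?) x)) ([]=⇒lookup x∈)
... | yes px | _  = px
... | no _   | ()

element : (S : Subset n) → Fin ∣ S ∣ → Fin n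
element (inside  ∷ S) zero    = zero
element (inside  ∷ S) (suc i) = suc (element S i)
element (outside ∷ S) i       = suc (element S i)

element-∈ : (S : Subset n) (i : Fin ∣ S ∣) → element S i ∈ S
element-∈ (inside  ∷ S) zero    = Vec.here
element-∈ (inside  ∷ S) (suc i) = Vec.there (element-∈ S i)
element-∈ (outside ∷ S) i       = Vec.there (element-∈ S i)

element-injective : (S : Subset n) → Injective _≡_ _≡_ (element S)
element-injective (inside  ∷ S) {zero}  {zero}  eq = refl
element-injective (inside  ∷ S) {suc i} {suc j} eq = cong suc (element-injective S (suc-injective eq))
element-injective (outside ∷ S) {i} {j} eq = element-injective S (suc-injective eq)

injective⇒≤∣∣ : (S : Subset n) {f : Fin m → Fin n} → Injective _≡_ _≡_ f → (∀ i → f i ∈ S) → m ≤ ∣ S ∣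
injective⇒≤∣∣ {m = zero}  S     f-inj f∈S = z≤n
injective⇒≤∣∣ {m = suc m} S {f} f-inj f∈S = ≤-<-trans
  (injective⇒≤∣∣ (S - f zero) (suc-injective ∘ f-inj)
    (λ i → x∈p∧x≢y⇒x∈p-y (f∈S (suc i)) (λ eq → 0≢1+n (sym (f-inj eq)))))
  (x∈p⇒∣p-x∣<∣p∣ (f∈S zero))

∈-⋃⁺ : (S : Fin m → Subset n) (i : Fin m) {x : Fin n} → x ∈ S i → x ∈ ⋃ (tabulate S)
∈-⋃⁺ S zero    x∈ = x∈p∪q⁺ (inj₁ x∈)
∈-⋃⁺ S (suc i) x∈ = x∈p∪q⁺ (inj₂ (∈-⋃⁺ (S ∘ suc) i x∈))

∈-⋃⁻ : (S : Fin m → Subset n) {x : Fin n} → x ∈ ⋃ (tabulate S) → ∃ λ i → x ∈ S i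
∈-⋃⁻ {m = zero}  S x∈ = contradiction x∈ ∉⊥
∈-⋃⁻ {m = suc m} S x∈ with x∈p∪q⁻ (S zero) _ x∈
... | inj₁ x∈₀ = zero , x∈₀
... | inj₂ x∈₊ = let i , x∈ᵢ = ∈-⋃⁻ (S ∘ suc) x∈₊ in suc i , x∈ᵢ

-- Pigeonhole: if every `R i` held somewhere, one witness for each `i` would inject `Fin m` into
-- `Fin n`, since disjointness keeps witnesses of different `i` apart.
unoccupied : n < m → {R : Fin m → Fin n → Set} → (∀ i v → Dec (R i v)) →
             (∀ {i j v} → R i v → R j v → i ≡ j) → ∃ λ i → ∀ v → ¬ R i v
unoccupied {m = m} n<m {R} R? disjoint =
  let i , ∄ = ¬∀⟶∃¬ m (λ i → ∃ (R i)) (λ i → any? (R? i)) ¬all in i , λ v r → ∄ (v , r)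
  where
  ¬all : ¬ (∀ i → ∃ (R i))
  ¬all rep = <⇒notInjective {f = proj₁ ∘ rep} n<m
    (λ {i} {j} eq → disjoint (proj₂ (rep i)) (subst (R j) (sym eq) (proj₂ (rep j))))

-- If `∁ S` has fewer than `w` elements, then so has `T`, which lies inside it; this leaves at least
-- `n + 1 - w`, hence at least `w`, elements in `∁ T`.
disjoint⇒large-complement : ∀ {w} (S T : Subset n) → (∀ {k} → k ∈ S → ¬ k ∈ T) → w + w ≤ suc n →
                            w ≤ ∣ ∁ S ∣ ⊎ w ≤ ∣ ∁ T ∣
disjoint⇒large-complement {n} {w} S T disj 2w≤1+n with w ≤? ∣ ∁ S ∣
... | yes w≤∣∁S∣ = inj₁ w≤∣∁S∣
... | no  w≰∣∁S∣ = inj₂ (subst (w ≤_) (sym (∣∁p∣≡n∸∣p∣ T)) (m+n≤o⇒m≤o∸n w w+∣T∣≤n))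
  where
  ∣T∣<w : ∣ T ∣ < w
  ∣T∣<w = ≤-<-trans (p⊆q⇒∣p∣≤∣q∣ {p = T} {∁ S} (λ k∈T → x∉p⇒x∈∁p (λ k∈S → disj k∈S k∈T))) (≰⇒> w≰∣∁S∣)
  w+∣T∣≤n : w + ∣ T ∣ ≤ n
  w+∣T∣≤n = ≤-pred (≤-trans (≤-trans (≤-reflexive (sym (+-suc w ∣ T ∣))) (+-monoʳ-≤ w ∣T∣<w)) 2w≤1+n)

-- Minors

-- What contractions onto `K t` leave on the vertices. Connectedness is an induction principle
-- without paths: a property that spreads along the edges inside a branch set holds on all of it
-- once it holds somewhere.
record CompleteQuotient (t : ℕ) (S : Graph) : Set₁ where
  open Graph S using (Vertex; Adj)
  field
    branch     : Vertex → Fin t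
    surjective : ∀ i → ∃ λ x → branch x ≡ i
    connected  : (P : Vertex → Set) →
                 (∀ {x y} → branch x ≡ branch y → Adj x y → P x → P y) →
                 ∀ {x y} → branch x ≡ branch y → P x → P y
    touching   : ∀ {i j} → i ≢ j → ∃₂ λ x y → branch x ≡ i × branch y ≡ j × Adj x y

completeQuotient : ∀ {t S} → Star Contracts S (K t) → CompleteQuotient t S
completeQuotient ε = record
  { branch     = id
  ; surjective = λ i → i , refl
  ; connected  = λ { P _ refl px → px }
  ; touching   = λ {i} {j} i≢j → i , j , refl , refl , i≢j
  }
completeQuotient {t} {S} (_◅_ {j = T} S⇒T T⇒K) = record
  { branch     = branch ∘ quot
  ; surjective = λ i → let p , eq = surjective′ i ; x , eq′ = surjective p in x , trans (cong branch eq′) eq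
  ; connected  = connected′
  ; touching   = touching′
  }
  where
  open Contracts S⇒T
  open CompleteQuotient (completeQuotient T⇒K) renaming (surjective to surjective′)

  connected′ : (P : Graph.Vertex S → Set) →
               (∀ {x y} → branch (quot x) ≡ branch (quot y) → Graph.Adj S x y → P x → P y) →
               ∀ {x y} → branch (quot x) ≡ branch (quot y) → P x → P y
  connected′ P closed {x} {y} eq px =
    -- The property passes to the quotient by asking for it on a whole fibre. `spread` justifies
    -- this: the only vertices identified are `u` and `v`, and `edge` joins them.
    connected (λ p → ∀ x → quot x ≡ p → P x) closed′ eq (λ x′ eq′ → spread (sym eq′) px) y refl
    where
    spread : ∀ {x y} → quot x ≡ quot y → P x → P y
    spread {x} {y} eq px with Equivalence.to (fibres x y) eq
    ... | inj₁ refl                 = px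
    ... | inj₂ (inj₁ (refl , refl)) = closed (cong branch eq) edge px
    ... | inj₂ (inj₂ (refl , refl)) = closed (cong branch eq) (Graph.sym S edge) px

    closed′ : ∀ {p q} → branch p ≡ branch q → Graph.Adj T p q →
              (∀ x → quot x ≡ p → P x) → ∀ y → quot y ≡ q → P y
    closed′ {p} {q} eq adj all y refl with Equivalence.to (adjacent p q) adj
    ... | _ , x , y′ , refl , eq′ , x~y′ =
      spread eq′ (closed (trans eq (cong branch (sym eq′))) x~y′ (all x refl))

  touching′ : ∀ {i j} → i ≢ j →
              ∃₂ λ x y → branch (quot x) ≡ i × branch (quot y) ≡ j × Graph.Adj S x y
  touching′ i≢j with touching i≢j
  ... | p , q , refl , refl , p~q with Equivalence.to (adjacent p q) p~q
  ...   | _ , x , y , refl , refl , x~y = x , y , refl , refl , x~y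

-- The branch sets need not cover `V`, because the contracted graph is only a subgraph.
record CliqueModel (t : ℕ) {V : Set} (_~_ : Rel V 0ℓ) : Set₁ where
  field
    In        : Fin t → V → Set
    In?       : ∀ i v → Dec (In i v)
    disjoint  : ∀ {i j v} → In i v → In j v → i ≡ j
    nonempty  : ∀ i → ∃ (In i)
    connected : ∀ i (P : V → Set) →
                (∀ {x y} → In i x → In i y → x ~ y → P x → P y) →
                ∀ {x y} → In i x → In i y → P x → P y
    touching  : ∀ {i j} → i ≢ j → ∃₂ λ x y → In i x × In j y × x ~ y

cliqueModel : ∀ {t G} {V : Set} {_~_ : Rel V 0ℓ} → DecidableEquality V →
              (name : Graph.Vertex G → V) → Injective _≡_ _≡_ name →
              (∀ {x y} → Graph.Adj G x y → name x ~ name y) →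
              K t IsMinorOf G → CliqueModel t _~_
cliqueModel {t} {G} {V} {_~_} _≟ⱽ_ name name-inj name-adj (S , S⊑G , S⇒K) = record
  { In        = In
  ; In?       = λ i v → any? (λ x → (name (embed x) ≟ⱽ v) ×-dec (branch x ≟ i))
  ; disjoint  = disjoint
  ; nonempty  = λ i → let x , eq = surjective i in name (embed x) , x , refl , eq
  ; connected = connected′
  ; touching  = λ i≢j → let x , y , eq , eq′ , x~y = touching i≢j in
      _ , _ , (x , refl , eq) , (y , refl , eq′) , name-adj (preserves x~y)
  }
  where
  open _⊑_ S⊑G
  open CompleteQuotient (completeQuotient S⇒K)

  In : Fin t → V → Set
  In i v = ∃ λ x → name (embed x) ≡ v × branch x ≡ i

  disjoint : ∀ {i j v} → In i v → In j v → i ≡ j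
  disjoint (x , eq , refl) (y , eq′ , refl) = cong branch (injective (name-inj (trans eq (sym eq′))))

  connected′ : ∀ i (P : V → Set) →
               (∀ {x y} → In i x → In i y → x ~ y → P x → P y) →
               ∀ {x y} → In i x → In i y → P x → P y
  connected′ i P closed (x , refl , eqx) (y , refl , eqy) px =
    -- Membership in branch set `i` is carried along with `P`, because `closed` asks for it at both
    -- ends of an edge.
    proj₁ (connected (λ x → P (name (embed x)) × branch x ≡ i)
      (λ { {x} {y} eq x~y (px , eqx) →
           closed (x , refl , eqx) (y , refl , trans (sym eq) eqx) (name-adj (preserves x~y)) px
         , trans (sym eq) eqx })
      (trans eqx (sym eqy)) (px , eqx))

-- Indexing the multiset

-- Position in the multiset {1⋆s, d}: the i-th one is just i, the entry d is nothing.
slot : ∀ {d} s → Fin (length (1 ⋆ s ++ [ d ])) → Maybe (Fin s)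
slot zero    zero    = nothing
slot (suc s) zero    = just zero
slot (suc s) (suc i) = Maybe.map suc (slot s i)

slot-injective : ∀ {d} s → Injective _≡_ _≡_ (slot {d} s)
slot-injective zero {zero} {zero} _ = refl
slot-injective (suc s) {zero} {zero} _ = refl
slot-injective {d} (suc s) {zero} {suc j} eq with slot {d} s j
slot-injective (suc s) {zero} {suc j} () | just _
slot-injective (suc s) {zero} {suc j} () | nothing
slot-injective {d} (suc s) {suc i} {zero} eq with slot {d} s i
slot-injective (suc s) {suc i} {zero} () | just _
slot-injective (suc s) {suc i} {zero} () | nothing
slot-injective (suc s) {suc i} {suc j} eq =
  cong suc (slot-injective s (Maybe.map-injective suc-injective eq))

slot-surjective : ∀ {d} s k → ∃ λ i → slot {d} s i ≡ k
slot-surjective zero    nothing        = zero , refl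
slot-surjective (suc s) nothing        = let i , eq = slot-surjective s nothing in suc i , cong (Maybe.map suc) eq
slot-surjective (suc s) (just zero)    = zero , refl
slot-surjective (suc s) (just (suc k)) = let i , eq = slot-surjective s (just k) in suc i , cong (Maybe.map suc) eq

lookup-slot : ∀ {d} s i → lookup (1 ⋆ s ++ [ d ]) i ≡ Maybe.maybe′ (λ _ → 1) d (slot s i)
lookup-slot zero    zero    = refl
lookup-slot (suc s) zero    = refl
lookup-slot {d} (suc s) (suc i) with slot {d} s i | lookup-slot {d} s i
... | just _  | eq = eq
... | nothing | eq = eq

splitAt-injective : ∀ m → Injective _≡_ _≡_ (splitAt m {n})
splitAt-injective m {i} {j} eq =
  trans (sym (join-splitAt m _ i)) (trans (cong (join m _) eq) (join-splitAt m _ j))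

-- The construction

injective? : (f : Fin m → Fin n) → Dec (∀ x y → f x ≡ f y → x ≡ y)
injective? f = all? λ x → all? λ y → (f x ≟ f y) →-dec (x ≟ y)

-- Attachment vertices are represented by indices in `Fin z`, so one pattern serves all gadgets.
record Attachment (z w h : ℕ) : Set where
  field
    nbr            : Fin h → Subset z
    nbr-large      : ∀ v → w ≤ ∣ nbr v ∣
    copy           : Subset z → Fin z → Fin h
    copy-injective : ∀ S → Injective _≡_ _≡_ (copy S)
    nbr-copy       : ∀ S → w ≤ ∣ S ∣ → ∀ k → nbr (copy S k) ≡ S

-- Gadget vertices are coded as pairs of a subset and an index below `z`, plus `r` spare ones; a
-- subset that is too small is replaced by the full set.
attachment : ∀ {z w h} → w ≤ z → 2 ^ z * z ≤ h → Attachment z w h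
attachment {z} {w} w≤z N≤h with m≤n⇒∃[o]m+o≡n N≤h
... | r , refl = record
  { nbr            = nbr
  ; nbr-large      = nbr-large
  ; copy           = copy
  ; copy-injective = λ S eq → combine-injectiveʳ (code S) _ (code S) _ (↑ˡ-injective r _ _ eq)
  ; nbr-copy       = nbr-copy
  }
  where
  open Inverse 2↔Bool using (to; from; strictlyInverseˡ)

  code : Subset z → Fin (2 ^ z)
  code S = funToFin (from ∘ Vec.lookup S)

  decode : Fin (2 ^ z) → Subset z
  decode c = Vec.tabulate (to ∘ finToFun c)

  decode-code : ∀ S → decode (code S) ≡ S
  decode-code S = trans
    (tabulate-cong (λ k → trans (cong to (finToFun-funToFin (from ∘ Vec.lookup S) k)) (strictlyInverseˡ _)))
    (tabulate∘lookup S)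

  enlarge : Subset z → Subset z
  enlarge S with w ≤? ∣ S ∣
  ... | yes _ = S
  ... | no  _ = full

  enlarge-large : ∀ S → w ≤ ∣ enlarge S ∣
  enlarge-large S with w ≤? ∣ S ∣
  ... | yes w≤∣S∣ = w≤∣S∣
  ... | no  _     = subst (w ≤_) (sym (∣⊤∣≡n z)) w≤z

  enlarge-id : ∀ S → w ≤ ∣ S ∣ → enlarge S ≡ S
  enlarge-id S w≤∣S∣ with w ≤? ∣ S ∣
  ... | yes _ = refl
  ... | no  w≰∣S∣ = contradiction w≤∣S∣ w≰∣S∣

  nbr⊎ : Fin (2 ^ z * z) ⊎ Fin r → Subset z
  -- Spare vertices get `enlarge full`, which is `full`, so that `enlarge-large` bounds both cases.
  nbr⊎ = [ enlarge ∘ decode ∘ proj₁ ∘ remQuot z , (λ _ → enlarge full) ]′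

  nbr : Fin (2 ^ z * z + r) → Subset z
  nbr v = nbr⊎ (splitAt (2 ^ z * z) v)

  nbr-large : ∀ v → w ≤ ∣ nbr v ∣
  nbr-large v with splitAt (2 ^ z * z) v
  ... | inj₁ _ = enlarge-large _
  ... | inj₂ _ = enlarge-large _

  copy : Subset z → Fin z → Fin (2 ^ z * z + r)
  copy S k = combine (code S) k ↑ˡ r

  nbr-copy : ∀ S → w ≤ ∣ S ∣ → ∀ k → nbr (copy S k) ≡ S
  nbr-copy S w≤∣S∣ k = trans (cong nbr⊎ (splitAt-↑ˡ _ (combine (code S) k) r)) (trans
    (cong (enlarge ∘ decode ∘ proj₁) (remQuot-combine (code S) k)) (trans
    (cong enlarge (decode-code S)) (enlarge-id S w≤∣S∣)))

module Construction (s z w h d e : ℕ) (A : Attachment z w h) where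
  open Attachment A

  base gadgets : ℕ
  base    = s + z
  gadgets = base ^ z * d ^ z

  -- Codes of non-injective maps are redirected to a fixed injection.
  repair : (Fin z → Fin base) → Fin z → Fin base
  repair f with injective? f
  ... | yes _ = f
  ... | no  _ = s ↑ʳ_

  repair-injective : ∀ f → Injective _≡_ _≡_ (repair f)
  repair-injective f with injective? f
  ... | yes f-inj = f-inj _ _
  ... | no  _     = ↑ʳ-injective s _ _

  repair-id : ∀ f → (∀ x y → f x ≡ f y → x ≡ y) → repair f ≡ f
  repair-id f f-inj with injective? f
  ... | yes _ = refl
  ... | no ¬f-inj = contradiction f-inj ¬f-inj

  place : Fin gadgets → Fin z → Fin base
  place g = repair (finToFun (proj₁ (remQuot (d ^ z) g)))

  place-injective : ∀ g → Injective _≡_ _≡_ (place g)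
  place-injective g = repair-injective _

  tint : Fin gadgets → Fin z → Fin d
  tint g = finToFun (proj₂ (remQuot {base ^ z} (d ^ z) g))

  -- The equalities are pointwise, as decoding an encoded function returns it only up to its values.
  -- `f′-inj` ensures that `repair` leaves the decoded placement alone.
  gadget : (f : Fin z → Fin base) → Injective _≡_ _≡_ f → (c : Fin z → Fin d) →
           ∃ λ g → place g ≗ f × tint g ≗ c
  gadget f f-inj c = combine F C , place-≗ , tint-≗
    where
    F = funToFin f
    C = funToFin c

    f′-inj : ∀ x y → finToFun F x ≡ finToFun F y → x ≡ y
    f′-inj x y eq = f-inj (trans (sym (finToFun-funToFin f x)) (trans eq (finToFun-funToFin f y)))

    place-≗ : place (combine F C) ≗ f
    place-≗ k = trans (cong (λ q → repair (finToFun (proj₁ q)) k) (remQuot-combine F C))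
      (trans (cong (λ f′ → f′ k) (repair-id (finToFun F) f′-inj)) (finToFun-funToFin f k))

    tint-≗ : tint (combine F C) ≗ c
    tint-≗ k = trans (cong (λ q → finToFun (proj₂ q) k) (remQuot-combine F C)) (finToFun-funToFin c k)

  V : Set
  V = Fin base ⊎ (Fin gadgets × Fin h)

  infix 4 _~_
  _~_ : Rel V 0ℓ
  inj₁ b       ~ inj₁ b′        = b ≢ b′
  inj₁ b       ~ inj₂ (g , v)   = ∃ λ k → k ∈ nbr v × place g k ≡ b
  inj₂ (g , v) ~ inj₁ b         = ∃ λ k → k ∈ nbr v × place g k ≡ b
  inj₂ (g , v) ~ inj₂ (g′ , v′) = g ≡ g′ × v ≢ v′

  ~-sym : ∀ {x y} → x ~ y → y ~ x
  ~-sym {inj₁ b}       {inj₁ b′}        b≢b′ eq     = b≢b′ (sym eq)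
  ~-sym {inj₁ b}       {inj₂ (g , v)}   adj         = adj
  ~-sym {inj₂ (g , v)} {inj₁ b}         adj         = adj
  ~-sym {inj₂ (g , v)} {inj₂ (g′ , v′)} (eq , v≢v′) = sym eq , v≢v′ ∘ sym

  ~-irrefl : ∀ {x} → ¬ x ~ x
  ~-irrefl {inj₁ b}       b≢b       = b≢b refl
  ~-irrefl {inj₂ (g , v)} (_ , v≢v) = v≢v refl

  ~-dec : ∀ x y → Dec (x ~ y)
  ~-dec (inj₁ b)       (inj₁ b′)        = ¬? (b ≟ b′)
  ~-dec (inj₁ b)       (inj₂ (g , v))   = any? λ k → (k ∈? nbr v) ×-dec (place g k ≟ b)
  ~-dec (inj₂ (g , v)) (inj₁ b)         = any? λ k → (k ∈? nbr v) ×-dec (place g k ≟ b)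
  ~-dec (inj₂ (g , v)) (inj₂ (g′ , v′)) = (g ≟ g′) ×-dec ¬? (v ≟ v′)

  abstract
    V↔ : Fin (base + gadgets * h) ↔ V
    V↔ = (↔-id _ ⊎-↔ *↔×) ↔-∘ +↔⊎

  open Inverse V↔ using () renaming (to to vertex; from to index; strictlyInverseˡ to vertex-index; strictlyInverseʳ to index-vertex)

  G : Graph
  G = record
    { order  = base + gadgets * h
    ; Adj    = λ x y → vertex x ~ vertex y
    ; sym    = λ {x} {y} → ~-sym {vertex x} {vertex y}
    ; irrefl = λ { {x} refl → ~-irrefl {vertex x} }
    ; adj?   = λ x y → ~-dec (vertex x) (vertex y)
    }

  -- Absence of a clique model

  module NoModel {t : ℕ} (base<1+t : base < suc t) (h<t : h < t) (2w≤1+z : w + w ≤ suc z)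
                 (model : CliqueModel (suc t) _~_) where
    open CliqueModel model

    -- The only outside neighbours of gadget `g` are the `place g k`, so a connected branch set that
    -- avoids them cannot leave it.
    confined : ∀ i g → (∀ k → ¬ In i (inj₁ (place g k))) → ∀ {v} → In i (inj₂ (g , v)) →
               ∀ {x} → In i x → ∃ λ v → x ≡ inj₂ (g , v)
    confined i g avoids {v} iv ix = connected i Inside closed iv ix (v , refl)
      where
      Inside : V → Set
      Inside x = ∃ λ v → x ≡ inj₂ (g , v)

      closed : ∀ {x y} → In i x → In i y → x ~ y → Inside x → Inside y
      closed {y = inj₁ _}        ix iy (k , _ , refl) (v , refl) = contradiction iy (avoids k)
      closed {y = inj₂ (_ , v′)} ix iy (refl , _)     (v , refl) = v′ , refl

    -- There are more branch sets than base vertices, so one avoids the base.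
    innermost : ∃ λ i → ∃ λ g → ∃ λ v → In i (inj₂ (g , v)) × (∀ b → ¬ In i (inj₁ b))
    innermost with unoccupied base<1+t (λ i b → In? i (inj₁ b)) disjoint
    ... | i , avoids with nonempty i
    ...   | inj₁ b       , ib = contradiction ib (avoids b)
    ...   | inj₂ (g , v) , iv = i , g , v , iv , avoids

    i₀ = proj₁ innermost
    g  = proj₁ (proj₂ innermost)
    v₀ = proj₁ (proj₂ (proj₂ innermost))

    i₀v₀ : In i₀ (inj₂ (g , v₀))
    i₀v₀ = proj₁ (proj₂ (proj₂ (proj₂ innermost)))

    i₀-inside : ∀ {x} → In i₀ x → ∃ λ v → x ≡ inj₂ (g , v)
    i₀-inside = confined i₀ g (λ k → proj₂ (proj₂ (proj₂ (proj₂ innermost))) (place g k)) i₀v₀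

    -- Every other branch set touches `i₀`, which lies in gadget `g`, and all neighbours of that
    -- gadget's vertices are in it or among the `place g k`.
    meets : ∀ i → (∃ λ k → In i (inj₁ (place g k))) ⊎ (∃ λ v → In i (inj₂ (g , v)))
    meets i with i ≟ i₀
    ... | yes refl = inj₂ (v₀ , i₀v₀)
    ... | no i≢i₀ with touching i≢i₀
    ...   | x , y , ix , i₀y , x~y with i₀-inside i₀y
    meets i | no _ | inj₁ _       , y , ix , i₀y , (k , _ , refl) | _ , refl = inj₁ (k , ix)
    meets i | no _ | inj₂ (_ , v) , y , ix , i₀y , (refl , _)     | _ , refl = inj₂ (v , ix)

    trace : Fin (suc t) → Subset z
    trace i = collect (λ k → In? i (inj₁ (place g k)))

    ∈trace : ∀ i {k} → k ∈ trace i → In i (inj₁ (place g k))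
    ∈trace i = ∈-collect⁻ (λ k → In? i (inj₁ (place g k)))

    -- If j misses the gadget, then every branch set either meets the attachment set, or is
    -- inside the gadget and has a vertex adjacent to the trace of j.  A branch set of the first
    -- kind is charged to a vertex attached exactly to the complement of that trace, of which
    -- there are z; so all 1 + t branch sets are charged to distinct vertices of the gadget.
    small-trace-absurd : ∀ j → (∀ v → ¬ In j (inj₂ (g , v))) → ¬ (w ≤ ∣ ∁ (trace j) ∣)
    small-trace-absurd j misses large = <⇒notInjective {f = proj₁ ∘ charge} (<-trans h<t ≤-refl)
      (λ {i} {i′} eq → charged-once (proj₂ (charge i)) (subst (Charged i′) (sym eq) (proj₂ (charge i′))))
      where
      Charged : Fin (suc t) → Fin h → Set
      Charged i v = (∃ λ k → In i (inj₁ (place g k)) × copy (∁ (trace j)) k ≡ v)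
                  ⊎ (In i (inj₂ (g , v)) × ∃ λ k → k ∈ nbr v × k ∈ trace j)

      charge : ∀ i → ∃ (Charged i)
      charge i with any? (λ k → In? i (inj₁ (place g k)))
      ... | yes (k , ik) = copy _ k , inj₁ (k , ik , refl)
      ... | no avoids with meets i | meets j
      ...   | inj₁ ik       | _               = contradiction ik avoids
      ...   | inj₂ _        | inj₂ (v , jv)   = contradiction jv (misses v)
      -- Here `j` meets the attachment set and `i` avoids it, so they differ and an edge joins them.
      -- As `i` is confined to the gadget and `j` misses it, that edge ends in the trace of `j`.
      ...   | inj₂ (_ , iv) | inj₁ jk with touching {i} {j} (λ { refl → avoids jk })
      ...     | x , y , ix , jy , x~y with confined i g (λ k ik → avoids (k , ik)) iv ix
      charge i | no _ | inj₂ _ | inj₁ _ | x , inj₁ _ , ix , jy , (k , k∈ , refl) | v , refl =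
        v , inj₂ (ix , k , k∈ , ∈-collect⁺ (λ k → In? j (inj₁ (place g k))) jy)
      charge i | no _ | inj₂ _ | inj₁ _ | x , inj₂ (_ , v′) , ix , jy , (refl , _) | v , refl =
        contradiction jy (misses v′)

      separated : ∀ {k v} → copy (∁ (trace j)) k ≡ v → ¬ (∃ λ k → k ∈ nbr v × k ∈ trace j)
      separated {k} refl (k′ , k′∈ , k′∈trace) =
        x∈p⇒x∉∁p k′∈trace (subst (k′ ∈_) (nbr-copy _ large k) k′∈)

      charged-once : ∀ {i i′ v} → Charged i v → Charged i′ v → i ≡ i′
      charged-once (inj₁ (k , ik , refl)) (inj₁ (k′ , ik′ , eq)) with copy-injective _ eq
      ... | refl = disjoint ik ik′
      charged-once (inj₁ (_ , _ , eq)) (inj₂ (_ , adj))   = contradiction adj (separated eq)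
      charged-once (inj₂ (_ , adj))   (inj₁ (_ , _ , eq)) = contradiction adj (separated eq)
      charged-once (inj₂ (iv , _))    (inj₂ (iv′ , _))    = disjoint iv iv′

    absurd : ⊥
    absurd with unoccupied (<-trans h<t ≤-refl) (λ i v → In? i (inj₂ (g , v))) disjoint
    -- Without `j` there remain `t` branch sets, still more than `h`, so a second one misses the
    -- gadget.
    ... | j , j-misses with unoccupied h<t (λ i v → In? (punchIn j i) (inj₂ (g , v)))
                              (λ iv iv′ → punchIn-injective j _ _ (disjoint iv iv′))
    ...   | i , i-misses with disjoint⇒large-complement (trace j) (trace (punchIn j i)) traces-disjoint 2w≤1+z
      where
      traces-disjoint : ∀ {k} → k ∈ trace j → ¬ k ∈ trace (punchIn j i)
      traces-disjoint k∈ k∈′ = punchInᵢ≢i j i (sym (disjoint (∈trace j k∈) (∈trace (punchIn j i) k∈′)))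
    ...     | inj₁ large = small-trace-absurd j j-misses large
    ...     | inj₂ large = small-trace-absurd (punchIn j i) i-misses large

  minorFree : ∀ {t} → base < suc t → h < t → w + w ≤ suc z → suc t -MinorFree G
  minorFree base<1+t h<t 2w≤1+z minor = NoModel.absurd base<1+t h<t 2w≤1+z
    (cliqueModel {G = G} (Sum.≡-dec _≟_ (Product.≡-dec _≟_ _≟_)) vertex vertex-injective id minor)
    where
    vertex-injective : Injective _≡_ _≡_ vertex
    vertex-injective {x} {y} eq = trans (sym (index-vertex x)) (trans (cong index eq) (index-vertex y))

  -- Colours and lists

  -- Shared colours, private colours (b , c) of the base vertices b, and extra gadget colours.
  -- Private colours of different vertices differ, so every tint of a gadget is usable.
  Colour : Set
  Colour = Fin s ⊎ ((Fin base × Fin d) ⊎ Fin e)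

  palette : ℕ
  palette = s + (base * d + e)

  abstract
    Colour↔ : Fin palette ↔ Colour
    Colour↔ = (↔-id _ ⊎-↔ ((*↔× ⊎-↔ ↔-id _) ↔-∘ +↔⊎)) ↔-∘ +↔⊎

  open Inverse Colour↔ using () renaming (to to colourOf; from to code; strictlyInverseˡ to colourOf-code; strictlyInverseʳ to code-colourOf)

  Allowed : V → Colour → Set
  Allowed x              (inj₁ i)              = ⊤
  Allowed (inj₁ b)       (inj₂ (inj₁ (b′ , _))) = b′ ≡ b
  Allowed (inj₁ b)       (inj₂ (inj₂ _))       = ⊥
  Allowed (inj₂ (g , v)) (inj₂ (inj₁ q))       = ∃ λ k → k ∈ nbr v × (place g k , tint g k) ≡ q
  Allowed (inj₂ _)       (inj₂ (inj₂ _))       = ⊤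

  allowed? : ∀ x c → Dec (Allowed x c)
  allowed? x              (inj₁ i)               = yes tt
  allowed? (inj₁ b)       (inj₂ (inj₁ (b′ , _))) = b′ ≟ b
  allowed? (inj₁ b)       (inj₂ (inj₂ _))        = no λ ()
  allowed? (inj₂ (g , v)) (inj₂ (inj₁ q))        =
    any? λ k → (k ∈? nbr v) ×-dec Product.≡-dec _≟_ _≟_ (place g k , tint g k) q
  allowed? (inj₂ _)       (inj₂ (inj₂ _))        = yes tt

  inList? : ∀ x → Decidable (λ c → Allowed (vertex x) (colourOf c))
  inList? x c = allowed? (vertex x) (colourOf c)

  L : ListAssignment G palette
  L x = collect (inList? x)

  class : Colour → Maybe (Fin s)
  class (inj₁ i) = just i
  class (inj₂ _) = nothing

  inClass? : ∀ k → Decidable (λ c → class (colourOf c) ≡ k)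
  inClass? k c = Maybe.≡-dec _≟_ (class (colourOf c)) k

  -- Intersecting with the union of all lists makes `covers` an equality even if some palette colour
  -- is on no list.
  part : Fin (length (1 ⋆ s ++ [ d ])) → Subset palette
  part i = collect (inClass? (slot s i)) ∩ ⋃ (tabulate L)

  part-large : ∀ x i {n} {f : Fin n → Colour} → Injective _≡_ _≡_ f →
               (∀ k → Allowed (vertex x) (f k)) → (∀ k → class (f k) ≡ slot s i) →
               n ≤ ∣ L x ∩ part i ∣
  part-large x i {f = f} f-inj allowed inClass = injective⇒≤∣∣ _ {code ∘ f}
    (λ {k} {l} eq → f-inj (trans (sym (colourOf-code (f k))) (trans (cong colourOf eq) (colourOf-code (f l)))))
    (λ k → x∈p∩q⁺ (code∈L k , x∈p∩q⁺ (code∈class k , ∈-⋃⁺ L x (code∈L k))))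
    where
    code∈L : ∀ k → code (f k) ∈ L x
    code∈L k = ∈-collect⁺ (inList? x) (subst (Allowed (vertex x)) (sym (colourOf-code (f k))) (allowed k))

    code∈class : ∀ k → code (f k) ∈ collect (inClass? (slot s i))
    code∈class k = ∈-collect⁺ (inClass? (slot s i)) (trans (cong class (colourOf-code (f k))) (inClass k))

  -- Witnesses for the entry `d`: the tints of `w` neighbours and the `e` extra colours. The tints
  -- are distinct because a private colour records its base vertex and `place g` is injective.
  gadgetColours : ∀ g v → Fin w ⊎ Fin e → Colour
  gadgetColours g v (inj₁ i) = inj₂ (inj₁ (place g k , tint g k))
    where k = element (nbr v) (inject≤ i (nbr-large v))
  gadgetColours g v (inj₂ i) = inj₂ (inj₂ i)

  gadgetColours-injective : ∀ g v → Injective _≡_ _≡_ (gadgetColours g v)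
  gadgetColours-injective g v {inj₁ _} {inj₁ _} eq = cong inj₁
    (inject≤-injective _ _ _ _ (element-injective (nbr v) (place-injective g
      (cong proj₁ (inj₁-injective (inj₂-injective eq))))))
  gadgetColours-injective g v {inj₂ _} {inj₂ _} refl = refl

  gadgetColours-allowed : ∀ g v k → Allowed (inj₂ (g , v)) (gadgetColours g v k)
  gadgetColours-allowed g v (inj₁ i) = _ , element-∈ (nbr v) _ , refl
  gadgetColours-allowed g v (inj₂ i) = tt

  gadgetColours-class : ∀ g v k → class (gadgetColours g v k) ≡ nothing
  gadgetColours-class g v (inj₁ i) = refl
  gadgetColours-class g v (inj₂ i) = refl

  isListAssignment : d ≤ w + e → IsListAssignmentOf (1 ⋆ s ++ [ d ]) G L
  isListAssignment d≤w+e = record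
    { part     = part
    ; disjoint = λ { {i} {j} i≢j (c , c∈) →
        let c∈i , c∈j = x∈p∩q⁻ (part i) (part j) c∈
        in i≢j (slot-injective s (trans (sym (∈part⇒class i c∈i)) (∈part⇒class j c∈j))) }
    ; covers   = ⊆-antisym
        (λ c∈ → let i , c∈i = ∈-⋃⁻ part c∈ in proj₂ (x∈p∩q⁻ _ (⋃ (tabulate L)) c∈i))
        (λ {c} c∈ → let i , eq = slot-surjective s (class (colourOf c))
                    in ∈-⋃⁺ part i (x∈p∩q⁺ (∈-collect⁺ (inClass? (slot s i)) (sym eq) , c∈)))
    ; large    = large
    }
    where
    ∈part⇒class : ∀ i {c} → c ∈ part i → class (colourOf c) ≡ slot s i
    ∈part⇒class i c∈ = ∈-collect⁻ (inClass? (slot s i)) (proj₁ (x∈p∩q⁻ _ (⋃ (tabulate L)) c∈))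

    large : ∀ i x → lookup (1 ⋆ s ++ [ d ]) i ≤ ∣ L x ∩ part i ∣
    large i x = subst (_≤ ∣ L x ∩ part i ∣) (sym (lookup-slot s i)) (bound (slot s i) (vertex x) refl refl)
      where
      bound : ∀ k y → slot s i ≡ k → vertex x ≡ y → Maybe.maybe′ (λ _ → 1) d k ≤ ∣ L x ∩ part i ∣
      bound (just j) _ i↦j _ = part-large x i {f = λ (_ : Fin 1) → inj₁ j}
        (λ { {zero} {zero} _ → refl }) (λ _ → tt) (λ _ → sym i↦j)
      bound nothing (inj₁ b) i↦ x↦b = part-large x i {f = λ c → inj₂ (inj₁ (b , c))}
        (λ { refl → refl })
        (λ c → subst (λ y → Allowed y (inj₂ (inj₁ (b , c)))) (sym x↦b) refl)
        (λ _ → sym i↦)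
      bound nothing (inj₂ (g , v)) i↦ x↦gv = ≤-trans d≤w+e (part-large x i {f = gadgetColours g v ∘ splitAt w}
        (λ p → splitAt-injective w (gadgetColours-injective g v p))
        (λ c → subst (λ y → Allowed y _) (sym x↦gv) (gadgetColours-allowed g v (splitAt w c)))
        (λ c → trans (gadgetColours-class g v (splitAt w c)) (sym i↦)))

  -- Absence of a colouring

  module NoColouring (s+e<h : s + e < h) (colouring : Colouring G L) where
    open Colouring colouring

    col : V → Colour
    col x = colourOf (colour (index x))

    col-allowed : ∀ x → Allowed x (col x)
    col-allowed x = subst (λ y → Allowed y (col x)) (vertex-index x)
      (∈-collect⁻ (inList? (index x)) (fromList (index x)))

    col-proper : ∀ {x y} → x ~ y → col x ≢ col y
    col-proper {x} {y} x~y eq = proper (subst₂ _~_ (sym (vertex-index x)) (sym (vertex-index y)) x~y)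
      (trans (sym (code-colourOf _)) (trans (cong code eq) (code-colourOf _)))

    unshared? : Decidable (λ b → class (col (inj₁ b)) ≡ nothing)
    unshared? b = Maybe.≡-dec _≟_ _ nothing

    unshared : Subset base
    unshared = collect unshared?

    shared-colour : ∀ {b} → b ∈ ∁ unshared → ∃ λ i → col (inj₁ b) ≡ inj₁ i
    shared-colour {b} b∈ with col (inj₁ b) in eq
    ... | inj₁ i = i , refl
    ... | inj₂ _ = contradiction (∈-collect⁺ unshared? (cong class eq)) (x∈∁p⇒x∉p b∈)

    unshared-colour : ∀ {b} → b ∈ unshared → ∃ λ c → col (inj₁ b) ≡ inj₂ (inj₁ (b , c))
    unshared-colour {b} b∈ with col (inj₁ b) | ∈-collect⁻ unshared? b∈ | col-allowed (inj₁ b)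
    ... | inj₂ (inj₁ (_ , c)) | _ | refl = c , refl

    col-injective : ∀ {b b′} → col (inj₁ b) ≡ col (inj₁ b′) → b ≡ b′
    col-injective {b} {b′} eq with b ≟ b′
    ... | yes b≡b′ = b≡b′
    ... | no  b≢b′ = contradiction eq (col-proper b≢b′)

    -- A proper colouring is injective on the base clique, and there are only `s` shared colours.
    ∣∁unshared∣≤s : ∣ ∁ unshared ∣ ≤ s
    ∣∁unshared∣≤s = injective⇒≤ {f = λ i → proj₁ (shared-colour (element-∈ (∁ unshared) i))}
      (λ {i} {j} eq → element-injective (∁ unshared) (col-injective (trans
        (proj₂ (shared-colour (element-∈ (∁ unshared) i))) (trans (cong inj₁ eq)
        (sym (proj₂ (shared-colour (element-∈ (∁ unshared) j))))))))

    z≤∣unshared∣ : z ≤ ∣ unshared ∣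
    z≤∣unshared∣ = +-cancelˡ-≤ s z ∣ unshared ∣ (≤-trans (m≤n+m∸n base ∣ unshared ∣) (≤-trans
      (+-monoʳ-≤ ∣ unshared ∣ (subst (_≤ s) (∣∁p∣≡n∸∣p∣ unshared) ∣∁unshared∣≤s))
      (≤-reflexive (+-comm ∣ unshared ∣ s))))

    chosen : Fin z → Fin base
    chosen k = element unshared (inject≤ k z≤∣unshared∣)

    chosen-injective : Injective _≡_ _≡_ chosen
    chosen-injective eq = inject≤-injective _ _ _ _ (element-injective unshared eq)

    chosen-colour : ∀ k → ∃ λ c → col (inj₁ (chosen k)) ≡ inj₂ (inj₁ (chosen k , c))
    chosen-colour k = unshared-colour (element-∈ unshared _)

    -- Each private colour on a gadget vertex's list is already used by an adjacent base vertex. The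
    -- clique of `h` gadget vertices is thus left with `s + e` colours.
    clash : ∀ g → place g ≗ chosen → tint g ≗ proj₁ ∘ chosen-colour → ⊥
    clash g place≗ tint≗ = <⇒notInjective {f = proj₁ ∘ free} s+e<h λ {v} {v′} eq →
      gadget-injective (trans (sym (proj₂ (free v))) (trans (cong (embed ∘ splitAt s) eq) (proj₂ (free v′))))
      where
      embed : Fin s ⊎ Fin e → Colour
      embed = [ inj₁ , inj₂ ∘ inj₂ ]′

      gadget-injective : ∀ {v v′} → col (inj₂ (g , v)) ≡ col (inj₂ (g , v′)) → v ≡ v′
      gadget-injective {v} {v′} eq with v ≟ v′
      ... | yes v≡v′ = v≡v′
      ... | no  v≢v′ = contradiction eq (col-proper (refl , v≢v′))

      place-colour : ∀ k → col (inj₁ (place g k)) ≡ inj₂ (inj₁ (place g k , tint g k))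
      place-colour k = subst₂ (λ b c → col (inj₁ b) ≡ inj₂ (inj₁ (b , c)))
        (sym (place≗ k)) (sym (tint≗ k)) (proj₂ (chosen-colour k))

      free : ∀ v → ∃ λ i → embed (splitAt s i) ≡ col (inj₂ (g , v))
      free v with col (inj₂ (g , v)) in eq | col-allowed (inj₂ (g , v))
      ... | inj₁ i              | _ = i ↑ˡ e , cong embed (splitAt-↑ˡ s i e)
      ... | inj₂ (inj₂ i)       | _ = s ↑ʳ i , cong embed (splitAt-↑ʳ s e i)
      ... | inj₂ (inj₁ _)       | k , k∈ , refl =
        contradiction (trans eq (sym (place-colour k))) (col-proper (k , k∈ , refl))

    absurd : ⊥
    absurd = let g , place≗ , tint≗ = gadget chosen chosen-injective (proj₁ ∘ chosen-colour)
             in clash g place≗ tint≗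

  notChoosable : d ≤ w + e → s + e < h → ¬ ((1 ⋆ s ++ [ d ]) -Choosable G)
  notChoosable d≤w+e s+e<h choosable =
    NoColouring.absurd s+e<h (choosable L (isListAssignment d≤w+e))

-- Choice of the parameters

theorem2 : (a : ℕ) → ∃ λ (t₁ : ℕ) → (t : ℕ) → t₁ ≤ t →
    Σ Graph λ G → (t -MinorFree G) × ¬ (((1 ⋆ (t ∸ 2 * a ∸ 6)) ++ [ 3 * a + 6 ]) -Choosable G)
-- The summand `2 ^ z * z` leaves room for all copies in a gadget; `2 * a + 6` makes the truncated
-- subtraction in `s` exact.
theorem2 a = 2 ^ z * z + (2 * a + 6) , construct
  where
  z w e : ℕ
  -- Here `w + w` is `suc z`, as needed for complements of disjoint traces, and `w + e` is the
  -- multiset entry `3 * a + 6`.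
  z = 2 * a + 5
  w = a + 3
  e = 2 * a + 3

  w≤z : w ≤ z
  w≤z = subst (w ≤_) (eq a) (m≤m+n w (a + 2))
    where
    eq : ∀ a → a + 3 + (a + 2) ≡ 2 * a + 5
    eq = solve-∀

  w+w≡1+z : ∀ a → a + 3 + (a + 3) ≡ suc (2 * a + 5)
  w+w≡1+z = solve-∀

  d≡w+e : ∀ a → 3 * a + 6 ≡ a + 3 + (2 * a + 3)
  d≡w+e = solve-∀

  construct : (t : ℕ) → 2 ^ z * z + (2 * a + 6) ≤ t →
    Σ Graph λ G → (t -MinorFree G) × ¬ (((1 ⋆ (t ∸ 2 * a ∸ 6)) ++ [ 3 * a + 6 ]) -Choosable G)
  construct t t₁≤t = G , subst (_-MinorFree G) 1+s+z≡t free , notChoosable (≤-reflexive (d≡w+e a)) s+e<h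
    where
    s h : ℕ
    s = t ∸ 2 * a ∸ 6
    -- This is `t - 2`: one more than the `s + e` usable colours and one less than the number of
    -- base vertices.
    h = s + (2 * a + 4)

    s≡ : t ∸ (2 * a + 6) ≡ s
    s≡ = sym (∸-+-assoc t (2 * a) 6)

    N≤s : 2 ^ z * z ≤ s
    N≤s = subst (2 ^ z * z ≤_) s≡ (m+n≤o⇒m≤o∸n (2 ^ z * z) t₁≤t)

    1+s+z≡t : suc (s + z) ≡ t
    1+s+z≡t = trans (sym (+-suc s z)) (trans (cong (s +_) (sym (+-suc (2 * a) 5))) (trans
      (cong (_+ (2 * a + 6)) (sym s≡)) (m∸n+n≡m (≤-trans (m≤n+m (2 * a + 6) (2 ^ z * z)) t₁≤t))))

    s+e<h : s + e < h
    s+e<h = ≤-reflexive (trans (sym (+-suc s e)) (cong (s +_) (sym (+-suc (2 * a) 3))))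

    h<s+z : h < s + z
    h<s+z = ≤-reflexive (trans (sym (+-suc s (2 * a + 4))) (cong (s +_) (sym (+-suc (2 * a) 4))))

    open Construction s z w h (3 * a + 6) e (attachment w≤z (≤-trans N≤s (m≤m+n s (2 * a + 4))))

    free : suc (s + z) -MinorFree G
    free = minorFree ≤-refl h<s+z (≤-reflexive (w+w≡1+z a))
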